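{- Let $G=(V=V_1\sqcup\dots\sqcup V_k,E)$ be a complete multipartite graph with $k\ge 2$ parts, and let $\mathrm{IT}(G)$ be the set of its interconnection trees. Then $$|\mathrm{IT}(G)|=(k-2)!\binom{|V|-k}{k-2}\prod_{i=1}^k|V_i|.$$
   Context: Graphs are finite, simple and undirected. A multipartite graph $G=(V=V_1\sqcup\dots\sqcup V_k,E)$ is a graph whose vertex set is partitioned into $k$ non-empty parts $V_1,\dots,V_k$, each of which is an independent set; $\mathrm{Part}:V\to[k]=\{1,\dots,k\}$ is defined by $\mathrm{Part}(v)=i$ iff $v\in V_i$. It is complete multipartite if for all $i\ne j$, all $u\in V_i$ and $v\in V_j$, $(u,v)\in E$. For an edge, $\mathrm{Part}((u,v))=(\mathrm{Part}(u),\mathrm{Part}(v))$, and for a set $F$ of edges, $\mathrm{Part}(F)=\{\mathrm{Part}(e)\mid e\in F\}$. The quotient graph of $G$ is $G_{\mathrm{Part}}=([k],\mathrm{Part}(E))$. An interconnection tree of $G$ is a set $T\subseteq E$ such that (1) $T$ is a matching in $G$, and (2) $\mathrm{Part}(T)$ is a spanning tree of $G_{\mathrm{Part}}$, distinct edges of $T$ having distinct projections (so that $|T|=k-1$). The binomial coefficient $\binom{a}{b}$ is $0$ when $0\le a<b$. -}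

module Defs where

open import Data.Fin.Base using (Fin)
open import Data.Fin.Properties using (_≟_; any?)
open import Data.Fin.Subset using (Subset; ∣_∣)
open import Data.List.Base using (List; []; _∷_; [_]; _++_; length; map; allFin)
open import Data.List.Relation.Unary.Linked using (Linked)
open import Data.List.Relation.Unary.Unique.Propositional using (Unique)
open import Data.Nat.Base using (ℕ; _≤_)
open import Data.Nat.ListAction using (product)
open import Data.Product.Base using (Σ; ∃₂; _×_; _,_; proj₁)
open import Data.Sum.Base using (_⊎_)
open import Data.Vec.Base using (tabulate)
open import Function.Bundles using (Inverse)
open import Function.Definitions using (StrictlySurjective)
open import Level using (0ℓ; suc)
open import Relation.Binary.Bundles using (Setoid)
open import Relation.Binary.Core using (Rel; _⇒_; _⇔_)
open import Relation.Binary.Construct.Closure.ReflexiveTransitive using (Star)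
open import Relation.Binary.Definitions using (Symmetric; Irreflexive; Decidable)
open import Relation.Binary.PropositionalEquality using (_≡_; _≢_; refl; sym; trans; setoid)
open import Relation.Nullary.Decidable using (does; _×-dec_)
open import Relation.Nullary.Negation using (¬_)
import Relation.Binary.Construct.On as On

-- A finite simple graph on Fin n.  A set of (undirected) edges on Fin n is
-- the same data, so this type also serves as the type of edge sets.
record Graph (n : ℕ) : Set₁ where
  field
    E      : Rel (Fin n) 0ℓ
    E-sym  : Symmetric E
    E-irr  : Irreflexive _≡_ E
    E?     : Decidable E

open Graph public

-- Equality of edge sets is extensional: the same pairs are edges.
edgeSets : ℕ → Setoid (suc 0ℓ) 0ℓ
edgeSets n = record
  { Carrier       = Graph n
  ; _≈_           = λ F F′ → E F ⇔ E F′
  ; isEquivalence = record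
    { refl  = (λ e → e) , (λ e → e)
    ; sym   = λ (f , g) → g , f
    ; trans = λ (f , g) (f′ , g′) → (λ e → f′ (f e)) , (λ e → g (g′ e))
    }
  }

-- Equality of unordered pairs.
SamePair : {A : Set} → Rel (A × A) 0ℓ
SamePair (a , b) (c , d) = (a ≡ c × b ≡ d) ⊎ (a ≡ d × b ≡ c)

Connected : {A : Set} → Rel A 0ℓ → Set
Connected R = ∀ x y → Star R x y

-- A cycle x, y₁, …, yₘ, x with x, y₁, …, yₘ distinct and m ≥ 2.
Cycle : {A : Set} → Rel A 0ℓ → Set
Cycle {A} R = ∃₂ λ (x : A) (ys : List A) →
  2 ≤ length ys × Unique (x ∷ ys) × Linked R (x ∷ ys ++ [ x ])

-- S is the edge relation of a spanning tree of H; it spans because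
-- connectedness ranges over all vertices of H.
record IsSpanningTree {k} (S : Rel (Fin k) 0ℓ) (H : Graph k) : Set where
  field
    subgraph  : S ⇒ E H
    connected : Connected S
    acyclic   : ¬ Cycle S

record MultipartiteGraph (n k : ℕ) : Set₁ where
  field
    graph       : Graph n
    part        : Fin n → Fin k
    nonempty    : StrictlySurjective _≡_ part
    independent : ∀ {u v} → part u ≡ part v → ¬ E graph u v

  block : Fin k → Subset n
  block i = tabulate λ v → does (part v ≟ i)

  Part : Rel (Fin n) 0ℓ → Rel (Fin k) 0ℓ
  Part F i j = ∃₂ λ u v → F u v × part u ≡ i × part v ≡ j

  quotient : Graph k
  quotient = record
    { E     = Part (E graph)
    ; E-sym = λ (u , v , e , p , q) → v , u , E-sym graph e , q , p
    ; E-irr = λ { refl (u , v , e , p , q) → independent (trans p (sym q)) e }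
    ; E?    = λ i j → any? λ u → any? λ v →
                E? graph u v ×-dec (part u ≟ i) ×-dec (part v ≟ j)
    }

  IsComplete : Set
  IsComplete = ∀ {u v} → part u ≢ part v → E graph u v

-- By symmetry of the edge relation, requiring that a vertex has at most one
-- neighbour says that distinct edges are disjoint.
IsMatching : ∀ {n} → Graph n → Set
IsMatching T = ∀ {u v w} → E T u v → E T u w → v ≡ w

module _ {n k} (G : MultipartiteGraph n k) where
  open MultipartiteGraph G

  record IsInterconnectionTree (T : Graph n) : Set where
    field
      subset       : E T ⇒ E graph
      matching     : IsMatching T
      spanningTree : IsSpanningTree (Part (E T)) quotient
      distinct     : ∀ {u v u′ v′} → E T u v → E T u′ v′ →
                     SamePair (part u , part v) (part u′ , part v′) →
                     SamePair (u , v) (u′ , v′)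

  IT : Setoid (suc 0ℓ) 0ℓ
  IT = On.setoid {B = Σ (Graph n) IsInterconnectionTree} (edgeSets n) proj₁

  ∏∣blocks∣ : ℕ
  ∏∣blocks∣ = product (map (λ i → ∣ block i ∣) (allFin k))

HasCardinality : ∀ {a ℓ} → Setoid a ℓ → ℕ → Set _
HasCardinality S m = Inverse S (setoid (Fin m))

{-# OPTIONS --safe #-}

-- A matching projects injectively onto a spanning tree iff its projection is connected and
-- each of its edges is a bridge.  In this form the trees can be counted by induction on the
-- vertices.  Let v be a vertex in block a.  If v is unmatched, delete it; if it is matched
-- to w, which then lies in another block b, contract the edge: discard v and w, and merge a
-- and b into one block of size n_a + n_b - 2.  Hence the number f of trees satisfies
--   f(n_1, ..., n_k) = f(..., n_a - 1, ...) + Σ_{b ≠ a} n_b f(..., n_a + n_b - 2, ...),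
-- and so does the claimed formula.  Blocks may become empty along the way.

module Submission where

open import Defs
open import Data.Bool.Base using (Bool; true; false; if_then_else_)
open import Data.Empty using (⊥)
open import Data.Fin.Base using (Fin; zero; suc; punchIn; punchOut)
open import Data.Fin.Properties using
  ( _≟_; any?; suc-injective; +↔⊎; punchInᵢ≢i; punchIn-punchOut
  ; punchOut-cong; punchOut-injective; punchOut-punchIn )
open import Data.Fin.Subset using (∣_∣)
open import Data.List.Base as List using (List; []; _∷_; [_]; _++_)
open import Data.List.Membership.DecPropositional using (_∈?_)
open import Data.List.Membership.Propositional using (_∈_)
open import Data.List.Relation.Unary.All as All using (All; []; _∷_)
open import Data.List.Relation.Unary.All.Properties using (¬Any⇒All¬)
open import Data.List.Relation.Unary.AllPairs using ([]; _∷_)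
open import Data.List.Relation.Unary.Any using (here; there)
open import Data.List.Relation.Unary.Linked using (Linked; [-]; _∷_)
open import Data.List.Relation.Unary.Unique.Propositional using (Unique)
open import Data.Nat.Base using (ℕ; zero; suc; pred; _≤_; _<_; s≤s; z≤n; _+_; _*_; _∸_; _!)
open import Data.Nat.Combinatorics using
  (_C_; nCk+nC[k+1]≡[n+1]C[k+1]; k>n⇒nCk≡0; nCk≡nC[n∸k]; nCn≡1)
open import Data.Nat.Combinatorics.Base using (_P′_)
import Data.Nat.ListAction as ListAction
import Data.Nat.Properties as ℕ
open import Data.Nat.Tactic.RingSolver using (solve-∀)
open import Data.Product.Base using (Σ; ∃; ∃₂; _×_; _,_; proj₁; proj₂)
open import Data.Sum.Base using (_⊎_; inj₁; inj₂)
open import Data.Sum.Function.Propositional using (_⊎-↔_)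
import Data.Vec.Base as Vec
open import Data.Vec.Functional using (updateAt; removeAt)
open import Data.Vec.Functional.Properties using (updateAt-updates; updateAt-minimal)
open import Function.Base using (_∘_; const; id)
open import Function.Bundles using (Inverse; _↔_; mk↔ₛ′)
open import Function.Construct.Composition using (inverse)
open import Function.Construct.Identity using (↔-id)
open import Function.Construct.Symmetry using (↔-sym)
open import Level using (Level; 0ℓ)
open import Relation.Binary.Bundles using (Setoid)
open import Relation.Binary.Construct.Closure.ReflexiveTransitive as Star
  using (Star; ε; _◅_; _◅◅_)
import Relation.Binary.Construct.On as On
open import Relation.Binary.Core using (Rel; _⇒_)
open import Relation.Binary.Definitions using (DecidableEquality; Symmetric)
open import Relation.Binary.PropositionalEquality
  using (_≡_; _≢_; _≗_; refl; sym; trans; cong; cong₂; subst; setoid; module ≡-Reasoning)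
open import Relation.Nullary.Decidable
  using (Dec; yes; no; does; dec-true; dec-false; _×-dec_; _⊎-dec_)
open import Relation.Nullary.Negation using (¬_; contradiction)
open import Algebra.Properties.Semiring.Sum ℕ.+-*-semiring using
  ( sum; sum-cong-≗; sum-remove; sum-replicate-zero; ∑-comm; ∑-distrib-+
  ; *-distribˡ-sum; *-distribʳ-sum )
open import Algebra.Properties.CommutativeMonoid.Sum ℕ.*-1-commutativeMonoid using ()
  renaming (sum to product; sum-remove to product-remove; sum-cong-≗ to product-cong)

-- In the bridge form the host graph disappears. A bridge has its ends in different blocks, so
-- completeness makes it an edge of G, and of two edges with the same projection one would be a
-- detour around the other. The induction therefore carries only a labelling of the vertices by
-- blocks and a set of live vertices. The formula satisfies the recursion for a simple reason. Let
-- n_a = p + 1, and let the other blocks, all nonempty for now, have sizes q_y + 1 and product P.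
-- Contracting an edge into block y replaces the factor q_y + 1 of P by p + q_y, while the q_y + 1
-- choices of the partner restore the lost factor; the total size after contraction is the same for
-- every y. So block y contributes P (p + q_y) times a common falling factorial, the sum over y is
-- linear in p and Q = sum of the q_y, and one identity in p and Q remains. Writing (k-2)! times the
-- binomial as a falling factorial keeps this free of division. If another block is empty, both
-- sides are 0.

private variable
  α β    : Level
  n k k′ : ℕ
  A      : Set

-- Contracted labellings need not be onto, so they do not come from a `MultipartiteGraph`. For
-- `ℓ = part` this unfolds to the projection used in the statement.
Part : (Fin n → Fin k) → Rel (Fin n) 0ℓ → Rel (Fin k) 0ℓ
Part ℓ F i j = ∃₂ λ u v → F u v × ℓ u ≡ i × ℓ v ≡ j

_∖_ : Rel A 0ℓ → A × A → Rel A 0ℓ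
(R ∖ e) x y = R x y × ¬ SamePair (x , y) e

samePair? : DecidableEquality A → ∀ p q → Dec (SamePair {A} p q)
samePair? _≟_ (a , b) (c , d) =
  ((a ≟ c) ×-dec (b ≟ d)) ⊎-dec ((a ≟ d) ×-dec (b ≟ c))

samePair-swapˡ : ∀ {a b : A} {p} → SamePair (a , b) p → SamePair (b , a) p
samePair-swapˡ (inj₁ (p , q)) = inj₂ (q , p)
samePair-swapˡ (inj₂ (p , q)) = inj₁ (q , p)

samePair-swapʳ : ∀ {a b : A} {p} → SamePair p (a , b) → SamePair p (b , a)
samePair-swapʳ (inj₁ (p , q)) = inj₂ (p , q)
samePair-swapʳ (inj₂ (p , q)) = inj₁ (p , q)

samePair-map : ∀ {B : Set} (f : A → B) {a b c d} →
               SamePair (a , b) (c , d) → SamePair (f a , f b) (f c , f d)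
samePair-map f (inj₁ (refl , refl)) = inj₁ (refl , refl)
samePair-map f (inj₂ (refl , refl)) = inj₂ (refl , refl)

samePair-suc⁻ : ∀ {a b c d : Fin n} →
                SamePair (suc a , suc b) (suc c , suc d) → SamePair (a , b) (c , d)
samePair-suc⁻ (inj₁ (refl , refl)) = inj₁ (refl , refl)
samePair-suc⁻ (inj₂ (refl , refl)) = inj₂ (refl , refl)

∖-sym : ∀ {R : Rel A 0ℓ} {e} → Symmetric R → Symmetric (R ∖ e)
∖-sym R-sym (r , ≢e) = R-sym r , ≢e ∘ samePair-swapˡ

Part-sym : ∀ {ℓ : Fin n → Fin k} {F} → Symmetric F → Symmetric (Part ℓ F)
Part-sym F-sym (u , v , e , p , q) = v , u , F-sym e , q , p

Part-map : ∀ {ℓ : Fin n → Fin k} {F F′} → F ⇒ F′ → Part ℓ F ⇒ Part ℓ F′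
Part-map f (u , v , e , p , q) = u , v , f e , p , q

-- Walks and simple paths

Avoiding : A → Rel A 0ℓ → Rel A 0ℓ
Avoiding a R x y = R x y × x ≢ a × y ≢ a

-- In either orientation the removed edge has an end in block `ℓ u`, which an avoiding walk never
-- enters.
avoid⇒∖ : ∀ {ℓ : Fin n → Fin k} {R u v} → Avoiding (ℓ u) (Part ℓ R) ⇒ Part ℓ (R ∖ (u , v))
avoid⇒∖ ((x , y , r , refl , refl) , x≢ , y≢) =
  x , y , (r , λ { (inj₁ (refl , _)) → x≢ refl ; (inj₂ (_ , refl)) → y≢ refl }) , refl , refl

-- The tail is searched before the head, so the visit to `a` that is found is the last one and what
-- follows it avoids `a`.
lastVisit : DecidableEquality A → ∀ {R : Rel A 0ℓ} {a b x} → b ≢ a → Star R x b →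
            (x ≢ a × Star (Avoiding a R) x b) ⊎
            ∃ λ y → R a y × y ≢ a × Star (Avoiding a R) y b
lastVisit _≟_ b≢a ε = inj₁ (b≢a , ε)
lastVisit _≟_ {a = a} {x = x} b≢a (r ◅ rs) with lastVisit _≟_ b≢a rs
... | inj₂ found = inj₂ found
... | inj₁ (y≢a , p) with x ≟ a
...   | yes refl = inj₂ (_ , r , y≢a , p)
...   | no  x≢a  = inj₁ (x≢a , (r , x≢a , y≢a) ◅ p)

star-reflexive : ∀ {R : Rel A 0ℓ} {x y} → x ≡ y → Star R x y
star-reflexive refl = ε

-- `Star` does not expose its vertices as a list, but `Cycle` needs one to express that they are
-- distinct.
data Path {A : Set} (R : Rel A 0ℓ) : A → List A → A → Set where
  []  : ∀ {x} → Path R x [] x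
  _∷_ : ∀ {x y ys z} → R x y → Path R y ys z → Path R x (y ∷ ys) z

close : ∀ {R : Rel A 0ℓ} {x ys y z} → Path R x ys y → R y z → Linked R (x ∷ ys ++ [ z ])
close []       r = r ∷ [-]
close (s ∷ ss) r = s ∷ close ss r

Path-map : ∀ {R S : Rel A 0ℓ} {x ys y} → R ⇒ S → Path R x ys y → Path S x ys y
Path-map f []       = []
Path-map f (r ∷ rs) = f r ∷ Path-map f rs

SimplePath : Rel A 0ℓ → A → A → Set
SimplePath R x y = ∃ λ ys → Path R x ys y × Unique (x ∷ ys)

suffix : ∀ {R : Rel A 0ℓ} {x y z ys} → x ∈ y ∷ ys → Path R y ys z → Unique (y ∷ ys) →
         SimplePath R x z
suffix (here refl) p        u       = _ , p , u
suffix (there x∈)  (_ ∷ p)  (_ ∷ u) = suffix x∈ p u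

-- Loop erasure: if `x` recurs on the simplified rest, the path starts at that recurrence instead.
simplify : DecidableEquality A → ∀ {R : Rel A 0ℓ} {x y} → Star R x y → SimplePath R x y
simplify _≟_ ε = [] , [] , [] ∷ []
simplify _≟_ {x = x} (_◅_ {j = z} r rs) with simplify _≟_ rs
... | ys , p , u with _∈?_ _≟_ x (z ∷ ys)
...   | yes x∈ = suffix x∈ p u
...   | no  x∉ = _ , r ∷ p , ¬Any⇒All¬ _ x∉ ∷ u

linked⇒star : ∀ {R : Rel A 0ℓ} {a x y} ys → x ≢ a → All (_≢ a) ys → y ≢ a →
              Linked R (x ∷ ys ++ [ y ]) → Star (Avoiding a R) x y
linked⇒star []       x≢ _          y≢ (r ∷ _)  = (r , x≢ , y≢) ◅ ε
linked⇒star (z ∷ ys) x≢ (z≢ ∷ ys≢) y≢ (r ∷ rs) = (r , x≢ , z≢) ◅ linked⇒star ys z≢ ys≢ y≢ rs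

-- Trees in terms of bridges

-- A marks the vertices not yet discarded by a contraction.
record IsTree {n k} (A : Fin n → Bool) (ℓ : Fin n → Fin k) (T : Rel (Fin n) 0ℓ) : Set where
  field
    alive     : ∀ {u v} → T u v → A u ≡ true
    matching  : ∀ {u v w} → T u v → T u w → v ≡ w
    connected : Connected (Part ℓ (T))
    bridge    : ∀ {u v} → T u v → ¬ Star (Part ℓ (T ∖ (u , v))) (ℓ u) (ℓ v)

  crossing : ∀ {u v} → T u v → ℓ u ≢ ℓ v
  crossing e p = bridge e (star-reflexive p)

module _ (G : MultipartiteGraph n k) (complete : MultipartiteGraph.IsComplete G) (T : Graph n) where
  open MultipartiteGraph G using (part; independent)

  interconnectionTree⇒tree : IsInterconnectionTree G T → IsTree (const true) part (E T)
  interconnectionTree⇒tree t = record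
    { alive     = λ _ → refl
    ; matching  = matching
    ; connected = connected
    ; bridge    = bridge
    }
    where
    open IsInterconnectionTree t
    open IsSpanningTree spanningTree
    -- A simple detour around an edge contradicts independence if it has length 0, distinctness of
    -- projections if it has length 1, and closes up to a cycle if it is longer.
    noPath : ∀ {u v i j ys} → E T u v → part u ≡ i → part v ≡ j →
             Path (Part part (E T ∖ (u , v))) i ys j → ¬ Unique (i ∷ ys)
    noPath e pu pv [] _ = independent (trans pu (sym pv)) (subset e)
    noPath e pu pv ((_ , _ , (f , f≢e) , px , py) ∷ []) _ =
      f≢e (distinct f e (inj₁ (trans px (sym pu) , trans py (sym pv))))
    noPath e pu pv p@(_ ∷ _ ∷ _) unique = acyclic
      ( _ , _ , s≤s (s≤s z≤n) , unique
      , close (Path-map (Part-map proj₁) p) (_ , _ , E-sym T e , pv , pu) )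

    bridge : ∀ {u v} → E T u v → ¬ Star (Part part (E T ∖ (u , v))) (part u) (part v)
    bridge e walk = let (_ , p , unique) = simplify _≟_ walk in noPath e refl refl p unique

  tree⇒interconnectionTree : IsTree (const true) part (E T) → IsInterconnectionTree G T
  tree⇒interconnectionTree t = record
    { subset       = complete ∘ crossing
    ; matching     = matching
    ; spanningTree = record
      { subgraph  = Part-map (complete ∘ crossing)
      ; connected = connected
      ; acyclic   = acyclic
      }
    ; distinct     = distinct
    }
    where
    open IsTree t
    acyclic : ¬ Cycle (Part part (E T))
    acyclic (x , [] , () , _)
    acyclic (x , _ ∷ [] , s≤s () , _)
    -- The rest of the cycle is a detour around its first edge: the step from `y` to `z` comes from
    -- another edge because `z` differs from `x`, and from `z` on the walk never meets `y` again.
    acyclic (x , y ∷ z ∷ zs , _ , (x≢y ∷ x≢z ∷ _) ∷ (y≢z ∷ y≢zs) ∷ _ ,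
             (u , v , e , refl , refl) ∷ yz ∷ rest) =
      bridge (E-sym T e)
        (first yz ◅ Star.map avoid⇒∖ (linked⇒star zs (y≢z ∘ sym) (All.map (_∘ sym) y≢zs) x≢y rest))
      where
      first : Part part (E T) (part v) z → Part part (E T ∖ (v , u)) (part v) z
      first (u′ , v′ , f , p , q) = u′ , v′ , (f , ≢f) , p , q
        where
        ≢f : ¬ SamePair (u′ , v′) (v , u)
        ≢f (inj₁ (_ , refl)) = x≢z q
        ≢f (inj₂ (refl , _)) = x≢y p
    -- Were the two edges different, the first would be a one-step detour around the second.
    distinct : ∀ {u v u′ v′} → E T u v → E T u′ v′ →
               SamePair (part u , part v) (part u′ , part v′) → SamePair (u , v) (u′ , v′)
    distinct {u} {v} {u′} {v′} e f s with samePair? _≟_ (u , v) (u′ , v′)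
    ... | yes p = p
    ... | no ≢f with s
    ...   | inj₁ (p , q) = contradiction ((u , v , (e , ≢f) , p , q) ◅ ε) (bridge f)
    ...   | inj₂ (p , q) =
      contradiction ((v , u , (E-sym T e , ≢f ∘ samePair-swapˡ) , q , p) ◅ ε) (bridge f)

-- Walks under contraction of blocks

module _ (ℓ : Fin (suc n) → Fin k) (c : Fin k → Fin k′)
         {R : Rel (Fin (suc n)) 0ℓ} {R′ : Rel (Fin n) 0ℓ} where

  -- Consecutive steps, once lifted, meet only up to `c`; `ker` supplies a walk that closes each
  -- gap.
  expand : (∀ {x y} → R′ x y → R (suc x) (suc y)) →
           (∀ {i j} → c i ≡ c j → Star (Part ℓ R) i j) →
           ∀ {i j} → Star (Part (c ∘ ℓ ∘ suc) R′) (c i) (c j) → Star (Part ℓ R) i j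
  expand up ker walk = go walk refl refl
    where
    go : ∀ {a b i j} → Star (Part (c ∘ ℓ ∘ suc) R′) a b → c i ≡ a → c j ≡ b → Star (Part ℓ R) i j
    go ε p q = ker (trans p (sym q))
    go ((x , y , r , p′ , q′) ◅ walk) p q =
      ker (trans p (sym p′)) ◅◅ ((suc x , suc y , up r , refl , refl) ◅ go walk q′ q)

  -- Steps through vertex zero collapse, since `c` identifies the blocks of their ends; all other
  -- steps survive.
  contract : (∀ {x y} → R (suc x) (suc y) → R′ x y) →
             (∀ {y} → R zero y → c (ℓ zero) ≡ c (ℓ y)) →
             (∀ {x} → R x zero → c (ℓ x) ≡ c (ℓ zero)) →
             ∀ {i j} → Star (Part ℓ R) i j → Star (Part (c ∘ ℓ ∘ suc) R′) (c i) (c j)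
  contract down loopˡ loopʳ ε = ε
  contract down loopˡ loopʳ ((zero , y , r , refl , refl) ◅ walk) =
    star-reflexive (loopˡ r) ◅◅ contract down loopˡ loopʳ walk
  contract down loopˡ loopʳ ((suc x , zero , r , refl , refl) ◅ walk) =
    star-reflexive (loopʳ r) ◅◅ contract down loopˡ loopʳ walk
  contract down loopˡ loopʳ ((suc x , suc y , r , refl , refl) ◅ walk) =
    (x , y , down r , refl , refl) ◅ contract down loopˡ loopʳ walk

-- Contraction of an edge at vertex zero

restrict : Graph (suc n) → Graph n
restrict T = record
  { E     = λ x y → E T (suc x) (suc y)
  ; E-sym = E-sym T
  ; E-irr = λ { refl → E-irr T refl }
  ; E?    = λ x y → E? T (suc x) (suc y)
  }

-- With s = zero the new vertex is isolated.
extend : Fin (suc n) → Graph n → Graph (suc n)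
extend {n} s T = record
  { E     = F
  ; E-sym = λ {x y} → F-sym {x} {y}
  ; E-irr = λ { {x} refl → F-irr {x} }
  ; E?    = F?
  }
  where
  F : Rel (Fin (suc n)) 0ℓ
  F zero    zero    = ⊥
  F zero    (suc y) = suc y ≡ s
  F (suc x) zero    = suc x ≡ s
  F (suc x) (suc y) = E T x y

  F-sym : Symmetric F
  F-sym {zero}  {suc y} e = e
  F-sym {suc x} {zero}  e = e
  F-sym {suc x} {suc y} e = E-sym T e

  F-irr : ∀ {x} → ¬ F x x
  F-irr {suc x} = E-irr T refl

  F? : ∀ x y → Dec (F x y)
  F? zero    zero    = no λ ()
  F? zero    (suc y) = suc y ≟ s
  F? (suc x) zero    = suc x ≟ s
  F? (suc x) (suc y) = E? T x y

-- The value `s = zero` encodes an unmatched vertex zero: `attached` then permits only a loop, which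
-- irreflexivity excludes.
record ZeroAttachedTo (s : Fin (suc n)) (T : Graph (suc n)) : Set where
  field
    attached : ∀ {y} → E T zero y → y ≡ s
    edge     : ∀ {y} → suc y ≡ s → E T zero (suc y)

merge : ∀ {a b : Fin (suc k)} → a ≢ b → Fin (suc k) → Fin k
merge {a = a} a≢b i with a ≟ i
... | yes _   = punchOut a≢b
... | no  a≢i = punchOut a≢i

module _ {a b : Fin (suc k)} (a≢b : a ≢ b) where

  merge-a : merge a≢b a ≡ punchOut a≢b
  merge-a with a ≟ a
  ... | yes _   = refl
  ... | no  a≢a = contradiction refl a≢a

  merge-≢ : ∀ {i} (a≢i : a ≢ i) → merge a≢b i ≡ punchOut a≢i
  merge-≢ {i} a≢i with a ≟ i
  ... | yes a≡i = contradiction a≡i a≢i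
  ... | no  _   = punchOut-cong a refl

  merge-identifies : merge a≢b a ≡ merge a≢b b
  merge-identifies = trans merge-a (sym (merge-≢ a≢b))

  merge-surjective : ∀ x → merge a≢b (punchIn a x) ≡ x
  merge-surjective x = trans (merge-≢ (punchInᵢ≢i a x ∘ sym)) (punchOut-punchIn a)

  merge-kernel : ∀ {i j} → merge a≢b i ≡ merge a≢b j → i ≡ j ⊎ SamePair (i , j) (a , b)
  merge-kernel {i} {j} p with a ≟ i | a ≟ j
  ... | yes refl | yes refl = inj₁ refl
  ... | yes refl | no  a≢j  = inj₂ (inj₁ (refl , sym (punchOut-injective a≢b a≢j p)))
  ... | no  a≢i  | yes refl = inj₂ (inj₂ (punchOut-injective a≢i a≢b p , refl))
  ... | no  a≢i  | no  a≢j  = inj₁ (punchOut-injective a≢i a≢j p)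

-- Unlike vertex zero, the partner `w` may have any index; marking it dead avoids renumbering the
-- other vertices.
kill : Fin n → (Fin n → Bool) → Fin n → Bool
kill w A = updateAt A w (const false)

-- Treats both cases of the recursion at once: `c = id` if vertex zero is isolated, `c = merge a≢b`
-- if it is matched. Together `loop` and `kernel` say that `c` identifies exactly the blocks joined
-- by an edge at vertex zero.
module Contraction {n k k′} {T : Rel (Fin (suc n)) 0ℓ} (T-sym : Symmetric T)
  {ℓ : Fin (suc n) → Fin k} {c : Fin k → Fin k′}
  (loop   : ∀ {y} → T zero y → c (ℓ zero) ≡ c (ℓ y))
  (kernel : ∀ {i j} → c i ≡ c j → i ≡ j ⊎ ∃ λ y → T zero y × SamePair (i , j) (ℓ zero , ℓ y))
  {A : Fin (suc n) → Bool} {A′ : Fin n → Bool}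
  where

  T′ : Rel (Fin n) 0ℓ
  T′ x y = T (suc x) (suc y)

  kernel⇒star : ∀ {R} → Symmetric R → (∀ {y} → T zero y → R zero y) →
                ∀ {i j} → c i ≡ c j → Star (Part ℓ R) i j
  kernel⇒star R-sym zeroEdge p with kernel p
  ... | inj₁ refl = ε
  ... | inj₂ (y , e , inj₁ (refl , refl)) = (zero , y , zeroEdge e , refl , refl) ◅ ε
  ... | inj₂ (y , e , inj₂ (refl , refl)) = (y , zero , R-sym (zeroEdge e) , refl , refl) ◅ ε

  loopˢ : ∀ {x} → T x zero → c (ℓ x) ≡ c (ℓ zero)
  loopˢ e = sym (loop (T-sym e))

  -- A detour below would lift to a detour above: the lift adds only edges at vertex zero, and none
  -- of these is the removed edge.
  contractTree : (∀ x → ∃ λ i → c i ≡ x) → (∀ {x y} → T′ x y → A′ x ≡ true) →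
                 IsTree A ℓ T → IsTree A′ (c ∘ ℓ ∘ suc) T′
  contractTree surjective alive′ t = record
    { alive     = alive′
    ; matching  = λ e f → suc-injective (matching e f)
    ; connected = connected′
    ; bridge    = λ e → bridge e ∘ expand ℓ c (λ (f , ≢e) → f , ≢e ∘ samePair-suc⁻)
        (kernel⇒star (∖-sym T-sym) (λ f → f , λ { (inj₁ ()) ; (inj₂ ()) }))
    }
    where
    open IsTree t
    connected′ : Connected (Part (c ∘ ℓ ∘ suc) T′)
    connected′ x y with surjective x | surjective y
    ... | i , refl | j , refl = contract ℓ c id loop loopˢ (connected i j)

  module Uncontract
    (cross    : ∀ {y} → T zero y → ℓ zero ≢ ℓ y)
    (alive    : ∀ {x y} → T x y → A x ≡ true)
    (unique₀  : ∀ {y z} → T zero y → T zero z → y ≡ z)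
    (isolated : ∀ {x y} → T (suc x) zero → ¬ T′ x y)
    (t′       : IsTree A′ (c ∘ ℓ ∘ suc) T′)
    where
    open IsTree t′ using ()
      renaming (matching to matching′; connected to connected′; bridge to bridge′)

    matching : ∀ {u v w} → T u v → T u w → v ≡ w
    matching {zero}                  e f = unique₀ e f
    matching {suc u} {zero}  {zero}  e f = refl
    matching {suc u} {zero}  {suc w} e f = contradiction f (isolated e)
    matching {suc u} {suc v} {zero}  e f = contradiction e (isolated f)
    matching {suc u} {suc v} {suc w} e f = cong suc (matching′ e f)

    -- A detour from block ℓ zero to block ℓ y avoiding the edge zero–y leaves block ℓ zero
    -- for the last time along some edge, which the rest of the detour shows not to be a
    -- bridge after the contraction.
    bridge₀ : ∀ {y} → T zero y → ¬ Star (Part ℓ (T ∖ (zero , y))) (ℓ zero) (ℓ y)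
    bridge₀ {y} e walk with lastVisit _≟_ (cross e ∘ sym) walk
    ... | inj₁ (a≢a , _) = a≢a refl
    ... | inj₂ (_ , (zero , _ , (f , ≢e) , _ , _) , _) = ≢e (inj₁ (refl , unique₀ f e))
    ... | inj₂ (_ , (suc u , zero , (f , ≢e) , _ , _) , _) =
      ≢e (inj₂ (unique₀ (T-sym f) e , refl))
    ... | inj₂ (_ , (suc u , suc v , (f , _) , p , refl) , _ , rest) =
      bridge′ (T-sym f)
        (Star.map (Part-map (λ (g , ≢f) → g , ≢f ∘ samePair-swapʳ)) (contract ℓ c
          (λ (g , ≢f) → g , ≢f ∘ samePair-map suc)
          (loop ∘ proj₁) (loopˢ ∘ proj₁)
          (Star.map avoid rest) ◅◅ star-reflexive (trans (sym (loop e)) (cong c (sym p)))))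
      where
      avoid : Avoiding (ℓ zero) (Part ℓ (T ∖ (zero , y))) ⇒ Part ℓ (T ∖ (suc u , suc v))
      avoid (r , x≢ , y≢) =
        avoid⇒∖ (Part-map proj₁ r , x≢ ∘ (λ q → trans q p) , y≢ ∘ (λ q → trans q p))

    uncontractTree : IsTree A ℓ T
    uncontractTree = record
      { alive     = alive
      ; matching  = matching
      ; connected = λ i j → expand ℓ c id (kernel⇒star T-sym id) (connected′ (c i) (c j))
      ; bridge    = bridge
      }
      where
      bridge : ∀ {u v} → T u v → ¬ Star (Part ℓ (T ∖ (u , v))) (ℓ u) (ℓ v)
      bridge {zero}          e walk = bridge₀ e walk
      bridge {suc u} {zero}  e walk = bridge₀ (T-sym e)
        (Star.reverse (Part-sym (∖-sym T-sym))
          (Star.map (Part-map (λ (g , ≢e) → g , ≢e ∘ samePair-swapʳ)) walk))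
      bridge {suc u} {suc v} e walk = bridge′ e (contract ℓ c
        (λ (g , ≢e) → g , ≢e ∘ samePair-map suc) (loop ∘ proj₁) (loopˢ ∘ proj₁) walk)

-- Cardinalities

Σ-Fin↔ : ∀ {q} (g : Fin q → ℕ) → Σ (Fin q) (Fin ∘ g) ↔ Fin (sum g)
Σ-Fin↔ {zero}  g = mk↔ₛ′ (λ ()) (λ ()) (λ ()) (λ ())
Σ-Fin↔ {suc q} g = inverse (inverse peel (↔-id _ ⊎-↔ Σ-Fin↔ (g ∘ suc))) (↔-sym +↔⊎)
  where
  peel : Σ (Fin (suc q)) (Fin ∘ g) ↔ (Fin (g zero) ⊎ Σ (Fin q) (Fin ∘ g ∘ suc))
  peel = mk↔ₛ′
    (λ { (zero , j) → inj₁ j ; (suc i , j) → inj₂ (i , j) })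
    (λ { (inj₁ j) → zero , j ; (inj₂ (i , j)) → suc i , j })
    (λ { (inj₁ j) → refl ; (inj₂ (i , j)) → refl })
    (λ { (zero , j) → refl ; (suc i , j) → refl })

module _ (S : Setoid α β) where
  open Setoid S using (Carrier; _≈_) renaming (refl to ≈-refl)

  Fibre : ∀ {q} → (Carrier → Fin q) → Fin q → Setoid α β
  Fibre σ i = On.setoid {B = Σ Carrier (λ x → σ x ≡ i)} S proj₁

  cardinality-empty : ¬ Carrier → HasCardinality S 0
  cardinality-empty ∄ = record
    { to        = λ x → contradiction x ∄
    ; from      = λ ()
    ; to-cong   = λ {x} → contradiction x ∄
    ; from-cong = λ { {()} }
    ; inverse   = (λ { {()} }) , (λ {x} → contradiction x ∄)
    }

  cardinality-fibres : ∀ {q} (σ : Carrier → Fin q) → (∀ {x y} → x ≈ y → σ x ≡ σ y) →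
                       (g : Fin q → ℕ) → (∀ i → HasCardinality (Fibre σ i) (g i)) →
                       HasCardinality S (sum g)
  cardinality-fibres σ σ-cong g h = inverse total (Σ-Fin↔ g)
    where
    module H i = Inverse (h i)

    index : ∀ {x i} → σ x ≡ i → Fin (g i)
    index {x} {i} p = H.to i (x , p)

    index-cong : ∀ {x y i j} (p : σ x ≡ i) (q : σ y ≡ j) → x ≈ y →
                 _≡_ {A = Σ _ (Fin ∘ g)} (i , index p) (j , index q)
    index-cong refl q x≈y with trans (σ-cong x≈y) q
    ... | refl = cong (_ ,_) (H.to-cong _ x≈y)

    total : Inverse S (setoid (Σ _ (Fin ∘ g)))
    total = record
      { to        = λ x → σ x , index refl
      ; from      = λ (i , j) → proj₁ (H.from i j)
      ; to-cong   = index-cong refl refl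
      ; from-cong = λ { refl → ≈-refl }
      ; inverse   = (λ { {i , j} y≈ → trans (index-cong refl (proj₂ (H.from i j)) y≈)
                                        (cong (i ,_) (H.inverseˡ i ≈-refl)) })
                  , (λ { {x} refl → H.inverseʳ (σ x) {x , refl} refl })
      }

-- Trees classified by the neighbour of vertex zero

Trees : (Fin n → Bool) → (Fin n → Fin k) → Setoid _ 0ℓ
Trees {n} A ℓ = On.setoid {B = Σ (Graph n) (IsTree A ℓ ∘ E)} (edgeSets n) proj₁

neighbour : Graph (suc n) → Fin (suc n)
neighbour T with any? (λ y → E? T zero (suc y))
... | yes (y , _) = suc y
... | no  _       = zero

neighbour-attached : ∀ {T : Graph (suc n)} → IsMatching T → ZeroAttachedTo (neighbour T) T
neighbour-attached {T = T} matching with any? (λ y → E? T zero (suc y))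
... | yes (y , e) = record { attached = λ f → matching f e ; edge = λ { refl → e } }
... | no ∄e       = record
  { attached = λ { {zero} e → refl ; {suc y} e → contradiction (y , e) ∄e } ; edge = λ () }

-- Shows that `neighbour`, which is found by a search, respects extensional equality of edge sets,
-- and that on `extend s T` it returns `s`.
attached-unique : ∀ {T T′ : Graph (suc n)} {s s′} → ZeroAttachedTo s T → ZeroAttachedTo s′ T′ →
                  (∀ {y} → E T zero y → E T′ zero y) → (∀ {y} → E T′ zero y → E T zero y) → s ≡ s′
attached-unique {s = zero}  {zero}  z z′ f g = refl
attached-unique {s = suc _} {_}     z z′ f g = attached z′ (f (edge z refl))
  where open ZeroAttachedTo
attached-unique {s = zero}  {suc _} z z′ f g = sym (attached z (g (edge z′ refl)))
  where open ZeroAttachedTo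

extend-attached : ∀ s (T : Graph n) → ZeroAttachedTo s (extend s T)
extend-attached s T = record { attached = λ { {suc y} e → e } ; edge = id }

extend-restrict : ∀ {s} {T : Graph (suc n)} → ZeroAttachedTo s T →
                  Setoid._≈_ (edgeSets (suc n)) (extend s (restrict T)) T
extend-restrict {s = s} {T} z = (λ {x} {y} → to x y) , (λ {x} {y} → from x y)
  where
  open ZeroAttachedTo z
  to : ∀ x y → E (extend s (restrict T)) x y → E T x y
  to zero    (suc y) e = edge e
  to (suc x) zero    e = E-sym T (edge e)
  to (suc x) (suc y) e = e
  from : ∀ x y → E T x y → E (extend s (restrict T)) x y
  from zero    zero    e = E-irr T refl e
  from zero    (suc y) e = attached e
  from (suc x) zero    e = attached (E-sym T e)
  from (suc x) (suc y) e = e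

extend-cong : ∀ {s} {T T′ : Graph n} → Setoid._≈_ (edgeSets n) T T′ →
              Setoid._≈_ (edgeSets (suc n)) (extend s T) (extend s T′)
extend-cong {s = s} {T} {T′} (f , g) =
  (λ {x} {y} → go {T} {T′} f {x} {y}) , (λ {x} {y} → go {T′} {T} g {x} {y})
  where
  go : ∀ {T T′ : Graph _} → (∀ {x y} → E T x y → E T′ x y) →
       ∀ {x y} → E (extend s T) x y → E (extend s T′) x y
  go f {zero}  {suc y} e = e
  go f {suc x} {zero}  e = e
  go f {suc x} {suc y} e = f e

module _ {A : Fin (suc n) → Bool} {ℓ : Fin (suc n) → Fin k} where

  treeNeighbour : Setoid.Carrier (Trees A ℓ) → Fin (suc n)
  treeNeighbour (T , _) = neighbour T

  treeNeighbour-attached : ((T , t) : Setoid.Carrier (Trees A ℓ)) → ZeroAttachedTo (neighbour T) T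
  treeNeighbour-attached (T , t) = neighbour-attached {T = T} (IsTree.matching t)

  treeNeighbour-cong : ∀ {T T′} → Setoid._≈_ (Trees A ℓ) T T′ → treeNeighbour T ≡ treeNeighbour T′
  treeNeighbour-cong {T} {T′} (f , g) =
    attached-unique (treeNeighbour-attached T) (treeNeighbour-attached T′) f g

  -- Once the neighbour of vertex zero is fixed, `extend s` and `restrict` are mutually inverse, so
  -- each case only has to show that both preserve trees.
  fibre↔ : ∀ {k′} {A′ : Fin n → Bool} {ℓ′ : Fin n → Fin k′} s →
    (∀ T → ZeroAttachedTo s T → IsTree A ℓ (E T) → IsTree A′ ℓ′ (E (restrict T))) →
    (∀ T′ → IsTree A′ ℓ′ (E T′) → IsTree A ℓ (E (extend s T′))) →
    Inverse (Fibre (Trees A ℓ) treeNeighbour s) (Trees A′ ℓ′)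
  fibre↔ s down up = record
    { to        = λ ((T , t) , p) → restrict T ,
        down T (subst (λ s → ZeroAttachedTo s T) p (treeNeighbour-attached (T , t))) t
    ; from      = λ (T′ , t′) → let T = extend s T′ , up T′ t′ in
        T , attached-unique (treeNeighbour-attached T) (extend-attached s T′) id id
    ; to-cong   = λ (f , g) → f , g
    ; from-cong = λ {T} {T′} → extend-cong {T = proj₁ T} {proj₁ T′}
    ; inverse   = (λ (f , g) → f , g)
                , (λ { {(T , t) , refl} {T′ , t′} p →
                    Setoid.trans (edgeSets (suc n)) {extend s T′} {extend s (restrict T)} {T}
                      (extend-cong {T = T′} {restrict T} p)
                      (extend-restrict {T = T} (treeNeighbour-attached (T , t))) })
    }

isolatedTree : ∀ {A : Fin (suc n) → Bool} {ℓ : Fin (suc n) → Fin k} →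
  Inverse (Fibre (Trees A ℓ) treeNeighbour zero) (Trees (A ∘ suc) (ℓ ∘ suc))
isolatedTree {n} {k} {A} {ℓ} = fibre↔ zero down up
  where
  no-edge : ∀ {T : Graph (suc n)} {y} → ZeroAttachedTo zero T → ¬ E T zero y
  no-edge {T} z e with ZeroAttachedTo.attached z e
  ... | refl = E-irr T refl e

  module _ (T : Graph (suc n)) (z : ZeroAttachedTo zero T) where
    symmetric : Symmetric (E T)
    symmetric = E-sym T

    loop : ∀ {y} → E T zero y → ℓ zero ≡ ℓ y
    loop e = contradiction e (no-edge {T} z)

    module C = Contraction {T = E T} symmetric {ℓ} {id} loop inj₁ {A} {A ∘ suc}

  down : ∀ T → ZeroAttachedTo zero T → IsTree A ℓ (E T) →
         IsTree (A ∘ suc) (ℓ ∘ suc) (E (restrict T))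
  down T z t = C.contractTree T z (λ x → x , refl) (IsTree.alive t) t

  up : ∀ T′ → IsTree (A ∘ suc) (ℓ ∘ suc) (E T′) → IsTree A ℓ (E (extend zero T′))
  up T′ t′ = C.Uncontract.uncontractTree T (extend-attached zero T′)
    (λ {y} e → contradiction e (none y)) (λ {x} {y} → alive x y)
    (λ {y} e → contradiction e (none y)) (λ ()) t′
    where
    T = extend zero T′
    none : ∀ y → ¬ E T zero y
    none y = no-edge {T} {y} (extend-attached zero T′)
    alive : ∀ x y → E T x y → A x ≡ true
    alive zero    y       e = contradiction e (none y)
    alive (suc x) (suc y) e = IsTree.alive t′ e

joinedTree : ∀ {A : Fin (suc n) → Bool} {ℓ : Fin (suc n) → Fin (suc k)} {w}
  (a≢b : ℓ zero ≢ ℓ (suc w)) → A zero ≡ true → A (suc w) ≡ true →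
  Inverse (Fibre (Trees A ℓ) treeNeighbour (suc w))
          (Trees (kill w (A ∘ suc)) (merge a≢b ∘ ℓ ∘ suc))
joinedTree {n} {k} {A} {ℓ} {w} a≢b Azero Aw = fibre↔ (suc w) down up
  where
  A′ = kill w (A ∘ suc)
  ℓ′ = merge a≢b ∘ ℓ ∘ suc

  module _ (T : Graph (suc n)) (z : ZeroAttachedTo (suc w) T) where
    open ZeroAttachedTo z

    symmetric : Symmetric (E T)
    symmetric = E-sym T

    loop : ∀ {y} → E T zero y → merge a≢b (ℓ zero) ≡ merge a≢b (ℓ y)
    loop e = trans (merge-identifies a≢b) (cong (merge a≢b ∘ ℓ) (sym (attached e)))

    kernel : ∀ {i j} → merge a≢b i ≡ merge a≢b j →
             i ≡ j ⊎ ∃ λ y → E T zero y × SamePair (i , j) (ℓ zero , ℓ y)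
    kernel p with merge-kernel a≢b p
    ... | inj₁ i≡j = inj₁ i≡j
    ... | inj₂ s   = inj₂ (suc w , edge refl , s)

    module C = Contraction {T = E T} symmetric {ℓ} {merge a≢b} loop kernel {A} {A′}

  down : ∀ T → ZeroAttachedTo (suc w) T → IsTree A ℓ (E T) → IsTree A′ ℓ′ (E (restrict T))
  down T z t = C.contractTree T z (λ x → _ , merge-surjective a≢b x) alive′ t
    where
    open IsTree t
    alive′ : ∀ {x y} → E T (suc x) (suc y) → A′ x ≡ true
    alive′ {x} e with x ≟ w
    ... | no x≢w = trans (updateAt-minimal x w (A ∘ suc) x≢w) (alive e)
    -- `suc w` is already matched to vertex zero, so it cannot have a neighbour `suc y`.
    ... | yes refl with matching e (E-sym T (ZeroAttachedTo.edge z refl))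
    ...   | ()

  up : ∀ T′ → IsTree A′ ℓ′ (E T′) → IsTree A ℓ (E (extend (suc w) T′))
  up T′ t′ = C.Uncontract.uncontractTree T z cross (λ {x} {y} → alive {x} {y})
    (λ {y} {y′} e f → trans (attached {y} e) (sym (attached {y′} f)))
    isolated t′
    where
    T = extend (suc w) T′
    z = extend-attached (suc w) T′
    open ZeroAttachedTo z
    cross : ∀ {y} → E T zero y → ℓ zero ≢ ℓ y
    cross {y} e p = a≢b (trans p (cong ℓ (attached {y} e)))
    -- `w` is dead in `A′`, so no edge of `T′` meets it; hence adding the edge to vertex zero
    -- preserves the matching.
    isolated : ∀ {x y} → Fin.suc x ≡ suc w → ¬ E T′ x y
    isolated refl e with trans (sym (IsTree.alive t′ e)) (updateAt-updates w (A ∘ suc))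
    ... | ()
    alive : ∀ {x y} → E T x y → A x ≡ true
    alive {zero}         e    = Azero
    alive {suc x} {zero} refl = Aw
    alive {suc x} {suc y} e with x ≟ w
    ... | yes refl = Aw
    ... | no x≢w   = trans (sym (updateAt-minimal x w (A ∘ suc) x≢w)) (IsTree.alive t′ e)

⟦_⟧ : Bool → ℕ
⟦ b ⟧ = if b then 1 else 0

δ : Fin k → Fin k → ℕ
δ i j = ⟦ does (i ≟ j) ⟧

blockSize : (Fin n → Bool) → (Fin n → Fin k) → Fin k → ℕ
blockSize A ℓ i = sum λ v → ⟦ A v ⟧ * δ (ℓ v) i

-- With a single block the falling factorial of the general formula would have -1 factors.
treeCount : (Fin (suc k) → ℕ) → ℕ
treeCount {zero}  m = 1
treeCount {suc k} m = ((sum m ∸ suc (suc k)) P′ k) * product m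

joinedCount : (A : Fin (suc n) → Bool) (ℓ : Fin (suc n) → Fin (suc (suc k))) → Fin n → ℕ
joinedCount A ℓ w with A (suc w) | ℓ zero ≟ ℓ (suc w)
... | true | no a≢b = treeCount (blockSize (kill w (A ∘ suc)) (merge a≢b ∘ ℓ ∘ suc))
-- No tree joins vertex zero to a dead vertex or to a vertex of its own block.
... | _    | _      = 0

fibreCount : (A : Fin (suc n) → Bool) (ℓ : Fin (suc n) → Fin (suc (suc k))) → Fin (suc n) → ℕ
fibreCount A ℓ zero    = treeCount (blockSize (A ∘ suc) (ℓ ∘ suc))
fibreCount A ℓ (suc w) = if A zero then joinedCount A ℓ w else 0

-- With a single block no edge can cross, so the empty edge set is the only tree, even if the block
-- is empty.
trees₁ : ∀ {A : Fin n → Bool} {ℓ : Fin n → Fin 1} → HasCardinality (Trees A ℓ) 1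
trees₁ {n} {A} {ℓ} = record
  { to        = λ _ → zero
  ; from      = λ _ → emptyGraph , record
    { alive = λ () ; matching = λ () ; connected = λ { zero zero → ε } ; bridge = λ () }
  ; to-cong   = λ _ → refl
  ; from-cong = λ _ → id , id
  ; inverse   = (λ { {zero} _ → refl }) ,
                (λ { {T , t} _ → (λ ()) , λ e → contradiction (Fin1 _ _) (IsTree.crossing t e) })
  }
  where
  Fin1 : ∀ (i j : Fin 1) → i ≡ j
  Fin1 zero zero = refl
  emptyGraph : Graph n
  emptyGraph = record { E = λ _ _ → ⊥ ; E-sym = id ; E-irr = λ _ () ; E? = λ _ _ → no λ () }

-- The numerical recursion

*-swap : ∀ x y z → x * (y * z) ≡ y * (x * z)
*-swap = solve-∀

P′-vanishes : ∀ {n k} → n < k → n P′ k ≡ 0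
P′-vanishes {n} {suc k} (s≤s n≤k) = cong (_* (n P′ k)) (ℕ.m≤n⇒m∸n≡0 n≤k)

-- `P′` unfolds by its smallest factor; this splits off the largest.
suc-P′-suc : ∀ n k → suc n P′ suc k ≡ suc n * (n P′ k)
suc-P′-suc n zero    = refl
suc-P′-suc n (suc k) = begin
  (n ∸ k) * (suc n P′ suc k)    ≡⟨ cong ((n ∸ k) *_) (suc-P′-suc n k) ⟩
  (n ∸ k) * (suc n * (n P′ k))  ≡⟨ *-swap (n ∸ k) (suc n) (n P′ k) ⟩
  suc n * ((n ∸ k) * (n P′ k))  ∎
  where
  open ≡-Reasoning

-- Induction by Pascal's rule. The range `n < k`, where both sides vanish, is included.
k!*nCk≡nP′k : ∀ n k → k ! * (n C k) ≡ n P′ k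
k!*nCk≡nP′k n zero = trans (ℕ.+-identityʳ (n C 0)) (trans (nCk≡nC[n∸k] {n = n} z≤n) (nCn≡1 n))
k!*nCk≡nP′k zero (suc k) = trans (cong (suc k ! *_) (k>n⇒nCk≡0 {0} {suc k} (s≤s z≤n)))
  (trans (ℕ.*-zeroʳ (suc k !)) (sym (P′-vanishes {0} {suc k} (s≤s z≤n))))
k!*nCk≡nP′k (suc n) (suc k) = begin
  suc k ! * (suc n C suc k)
    ≡⟨ cong (suc k ! *_) (nCk+nC[k+1]≡[n+1]C[k+1] n k) ⟨
  suc k ! * (n C k + n C suc k)
    ≡⟨ ℕ.*-distribˡ-+ (suc k !) (n C k) (n C suc k) ⟩
  suc k * k ! * (n C k) + suc k ! * (n C suc k)
    ≡⟨ cong (_+ suc k ! * (n C suc k)) (ℕ.*-assoc (suc k) (k !) (n C k)) ⟩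
  suc k * (k ! * (n C k)) + suc k ! * (n C suc k)
    ≡⟨ cong₂ (λ x y → suc k * x + y) (k!*nCk≡nP′k n k) (k!*nCk≡nP′k n (suc k)) ⟩
  suc k * (n P′ k) + (n ∸ k) * (n P′ k)            ≡⟨ ℕ.*-distribʳ-+ (n P′ k) (suc k) (n ∸ k) ⟨
  (suc k + (n ∸ k)) * (n P′ k)                     ≡⟨ absorb ⟩
  suc n * (n P′ k)                                 ≡⟨ suc-P′-suc n k ⟨
  suc n P′ suc k                                   ∎
  where
  open ≡-Reasoning
  absorb : (suc k + (n ∸ k)) * (n P′ k) ≡ suc n * (n P′ k)
  absorb with k ℕ.≤? n
  ... | yes k≤n = cong (λ x → suc x * (n P′ k)) (ℕ.m+[n∸m]≡n k≤n)
  -- Here `n ∸ k` is truncated and the first factors disagree, but the common factor `n P′ k` is 0.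
  ... | no  k≰n rewrite P′-vanishes (ℕ.≰⇒> k≰n) =
    trans (ℕ.*-zeroʳ (k + (n ∸ k))) (sym (ℕ.*-zeroʳ n))

-- With `b = p + q - 1` and the common factor `b P′ j` removed, this is (b - j) p + (j + 2) p + q =
-- (b + 1)(p + 1). The separate cases are those where a subtraction would be truncated.
P′-recursion : ∀ j p q →
  (pred (p + q) P′ suc j) * p + (pred (p + q) P′ j) * (suc (suc j) * p + q)
    ≡ ((p + q) P′ suc j) * suc p
P′-recursion j p q with p + q in p+q≡
... | zero rewrite ℕ.m+n≡0⇒m≡0 p p+q≡ | ℕ.m+n≡0⇒n≡0 p p+q≡ | ℕ.0∸n≡0 j | ℕ.*-zeroʳ j =
  ℕ.*-zeroʳ (0 P′ j)
... | suc b rewrite suc-P′-suc b j with j ℕ.≤? b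
...   | no j≰b rewrite P′-vanishes (ℕ.≰⇒> j≰b) | ℕ.*-zeroʳ (b ∸ j) | ℕ.*-zeroʳ b = refl
...   | yes j≤b = begin
  r * F * p + F * (suc (suc j) * p + q)    ≡⟨ lhs r F p j q ⟩
  F * (suc (j + r) * p + (p + q))
    ≡⟨ cong₂ (λ x y → F * (suc x * p + y)) (ℕ.m+[n∸m]≡n j≤b) p+q≡ ⟩
  F * (suc b * p + suc b)                  ≡⟨ rhs F b p ⟩
  suc b * F * suc p                        ∎
  where
  open ≡-Reasoning
  r = b ∸ j
  F = b P′ j
  lhs : ∀ r F p j q → r * F * p + F * (suc (suc j) * p + q) ≡ F * (suc (j + r) * p + (p + q))
  lhs = solve-∀
  rhs : ∀ F b p → F * (suc b * p + suc b) ≡ suc b * F * suc p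
  rhs = solve-∀

-- Block sizes under merging and deletion

δ-refl : ∀ (i : Fin k) → δ i i ≡ 1
δ-refl i = cong ⟦_⟧ (dec-true (i ≟ i) refl)

δ-≢ : ∀ {i j : Fin k} → i ≢ j → δ i j ≡ 0
δ-≢ {i = i} {j} i≢j = cong ⟦_⟧ (dec-false (i ≟ j) i≢j)

sum-δ : ∀ (j : Fin k) (f : Fin k → ℕ) → sum (λ i → δ j i * f i) ≡ f j
sum-δ {suc k} j f = begin
  sum (λ i → δ j i * f i)
    ≡⟨ sum-remove {i = j} (λ i → δ j i * f i) ⟩
  δ j j * f j + sum (λ i → δ j (punchIn j i) * f (punchIn j i))
    ≡⟨ cong₂ (λ x y → x * f j + y) (δ-refl j)
         (sum-cong-≗ λ i → cong (_* f (punchIn j i)) (δ-≢ (punchInᵢ≢i j i ∘ sym))) ⟩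
  1 * f j + sum {k} (λ _ → 0)
    ≡⟨ cong (1 * f j +_) (sum-replicate-zero k) ⟩
  1 * f j + 0                                                   ≡⟨ simp (f j) ⟩
  f j ∎
  where
  open ≡-Reasoning
  simp : ∀ x → 1 * x + 0 ≡ x
  simp = solve-∀

-- Vertices are grouped by block. This turns the sum over partners `w` into the sum over blocks,
-- weighted by their sizes.
sum-blocks : ∀ (A : Fin n → Bool) (ℓ : Fin n → Fin k) (f : Fin k → ℕ) →
             sum (λ v → ⟦ A v ⟧ * f (ℓ v)) ≡ sum (λ i → blockSize A ℓ i * f i)
sum-blocks A ℓ f = begin
  sum (λ v → ⟦ A v ⟧ * f (ℓ v))
    ≡⟨ sum-cong-≗ (λ v → cong (⟦ A v ⟧ *_) (sym (sum-δ (ℓ v) f))) ⟩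
  sum (λ v → ⟦ A v ⟧ * sum (λ i → δ (ℓ v) i * f i))
    ≡⟨ sum-cong-≗ (λ v → *-distribˡ-sum ⟦ A v ⟧ (λ i → δ (ℓ v) i * f i)) ⟩
  sum (λ v → sum (λ i → ⟦ A v ⟧ * (δ (ℓ v) i * f i)))
    ≡⟨ ∑-comm (λ v i → ⟦ A v ⟧ * (δ (ℓ v) i * f i)) ⟩
  sum (λ i → sum (λ v → ⟦ A v ⟧ * (δ (ℓ v) i * f i)))
    ≡⟨ sum-cong-≗ (λ i → sum-cong-≗ (λ v → ℕ.*-assoc ⟦ A v ⟧ (δ (ℓ v) i) (f i))) ⟨
  sum (λ i → sum (λ v → ⟦ A v ⟧ * δ (ℓ v) i * f i))
    ≡⟨ sum-cong-≗ (λ i → *-distribʳ-sum (f i) (λ v → ⟦ A v ⟧ * δ (ℓ v) i)) ⟨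
  sum (λ i → blockSize A ℓ i * f i)                   ∎
  where open ≡-Reasoning

-- The preimage of `x` under `merge` consists of `punchIn a x` and, if `x` stands for `b`, also of
-- `a`.
δ-merge : ∀ {a b : Fin (suc k)} (a≢b : a ≢ b) i x →
          δ (merge a≢b i) x ≡ δ i a * δ (punchOut a≢b) x + δ i (punchIn a x)
δ-merge {a = a} a≢b i x with a ≟ i
... | yes refl rewrite δ-refl a | δ-≢ (punchInᵢ≢i a x ∘ sym) = simp _
  where
  simp : ∀ x → x ≡ 1 * x + 0
  simp = solve-∀
... | no a≢i rewrite δ-≢ (a≢i ∘ sym) with punchOut a≢i ≟ x
...   | yes refl rewrite punchIn-punchOut a≢i = sym (δ-refl i)
...   | no  i≢x  = sym (δ-≢ {i = i} {punchIn a x}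
    λ { refl → i≢x (trans (punchOut-cong a refl) (punchOut-punchIn a)) })

blockSize-merge : ∀ {a b : Fin (suc k)} (a≢b : a ≢ b) (A : Fin n → Bool) ℓ x →
  blockSize A (merge a≢b ∘ ℓ) x ≡ blockSize A ℓ a * δ (punchOut a≢b) x + blockSize A ℓ (punchIn a x)
blockSize-merge {a = a} a≢b A ℓ x = begin
  sum (λ v → ⟦ A v ⟧ * δ (merge a≢b (ℓ v)) x)
    ≡⟨ sum-cong-≗ (λ v → trans (cong (⟦ A v ⟧ *_) (δ-merge a≢b (ℓ v) x)) (expand′ ⟦ A v ⟧ _ _ _)) ⟩
  sum (λ v → ⟦ A v ⟧ * δ (ℓ v) a * d + ⟦ A v ⟧ * δ (ℓ v) (punchIn a x))
    ≡⟨ ∑-distrib-+ (λ v → ⟦ A v ⟧ * δ (ℓ v) a * d) (λ v → ⟦ A v ⟧ * δ (ℓ v) (punchIn a x)) ⟩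
  sum (λ v → ⟦ A v ⟧ * δ (ℓ v) a * d) + blockSize A ℓ (punchIn a x)
    ≡⟨ cong (_+ blockSize A ℓ (punchIn a x)) (*-distribʳ-sum d (λ v → ⟦ A v ⟧ * δ (ℓ v) a)) ⟨
  blockSize A ℓ a * d + blockSize A ℓ (punchIn a x) ∎
  where
  open ≡-Reasoning
  d = δ (punchOut a≢b) x
  expand′ : ∀ s x y z → s * (x * y + z) ≡ s * x * y + s * z
  expand′ = solve-∀

blockSize-kill : ∀ {A : Fin n → Bool} {w} → A w ≡ true → (ℓ : Fin n → Fin k) → ∀ x →
                 blockSize A ℓ x ≡ δ (ℓ w) x + blockSize (kill w A) ℓ x
blockSize-kill {suc n} {A = A} {w} Aw ℓ x = begin
  blockSize A ℓ x
    ≡⟨ sum-remove {i = w} (λ v → ⟦ A v ⟧ * δ (ℓ v) x) ⟩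
  ⟦ A w ⟧ * δ (ℓ w) x + rest A
    ≡⟨ cong₂ (λ b y → ⟦ b ⟧ * δ (ℓ w) x + y) Aw
         (sum-cong-≗ λ v → cong (λ b → ⟦ b ⟧ * δ (ℓ (punchIn w v)) x)
           (sym (updateAt-minimal (punchIn w v) w A (punchInᵢ≢i w v)))) ⟩
  1 * δ (ℓ w) x + rest (kill w A)
    ≡⟨ cong (_+ rest (kill w A)) (ℕ.*-identityˡ (δ (ℓ w) x)) ⟩
  δ (ℓ w) x + rest (kill w A)
    ≡⟨ cong (λ b → δ (ℓ w) x + (⟦ b ⟧ * δ (ℓ w) x + rest (kill w A))) (updateAt-updates w A) ⟨
  δ (ℓ w) x + (⟦ kill w A w ⟧ * δ (ℓ w) x + rest (kill w A))
    ≡⟨ cong (δ (ℓ w) x +_) (sum-remove {i = w} (λ v → ⟦ kill w A v ⟧ * δ (ℓ v) x)) ⟨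
  δ (ℓ w) x + blockSize (kill w A) ℓ x             ∎
  where
  open ≡-Reasoning
  rest : (Fin (suc n) → Bool) → ℕ
  rest B = sum (λ v → ⟦ B (punchIn w v) ⟧ * δ (ℓ (punchIn w v)) x)

treeCount-cong : ∀ {m m′ : Fin (suc k) → ℕ} → m ≗ m′ → treeCount m ≡ treeCount m′
treeCount-cong {zero}  m≗ = refl
treeCount-cong {suc k} m≗ =
  cong₂ (λ s p → ((s ∸ suc (suc k)) P′ k) * p) (sum-cong-≗ m≗) (product-cong m≗)

-- Block sizes after block a, with p unused vertices left besides the one just used, is
-- merged into block y along an edge whose other end is in block y.
contractSizes : (Fin k → ℕ) → ℕ → Fin k → Fin k → ℕ
contractSizes m p y x = (p * δ y x + m x) ∸ δ y x

contractSizes-same : ∀ (m : Fin k → ℕ) p y → contractSizes m p y y ≡ p + m y ∸ 1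
contractSizes-same m p y rewrite δ-refl y | ℕ.*-identityʳ p = refl

contractSizes-other : ∀ (m : Fin (suc k) → ℕ) p y x →
  contractSizes m p y (punchIn y x) ≡ m (punchIn y x)
contractSizes-other m p y x rewrite δ-≢ (punchInᵢ≢i y x ∘ sym) | ℕ.*-zeroʳ p = refl

-- Since block `y` is nonempty, the subtraction in its new size is not truncated.
sum-contractSizes : ∀ (m : Fin (suc k) → ℕ) p y {q} → m y ≡ suc q →
                    sum (contractSizes m p y) ≡ pred (p + sum m)
sum-contractSizes m p y {q} my = begin
  sum (contractSizes m p y)                     ≡⟨ sum-remove {i = y} (contractSizes m p y) ⟩
  contractSizes m p y y + sum (removeAt (contractSizes m p y) y)
    ≡⟨ cong₂ _+_ (contractSizes-same m p y) (sum-cong-≗ (contractSizes-other m p y)) ⟩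
  p + m y ∸ 1 + rest                             ≡⟨ cong (λ z → p + z ∸ 1 + rest) my ⟩
  p + suc q ∸ 1 + rest                           ≡⟨ cong (λ z → z ∸ 1 + rest) (ℕ.+-suc p q) ⟩
  p + q + rest                                   ≡⟨ cong pred (shift p q rest) ⟩
  pred (p + (suc q + rest))                      ≡⟨ cong (λ z → pred (p + (z + rest))) my ⟨
  pred (p + (m y + rest))
    ≡⟨ cong (λ z → pred (p + z)) (sum-remove {i = y} m) ⟨
  pred (p + sum m)                               ∎
  where
  open ≡-Reasoning
  rest = sum (removeAt m y)
  shift : ∀ p q r → suc (p + q + r) ≡ p + (suc q + r)
  shift = solve-∀

-- The merger replaces the factor `m y` by `p + m y ∸ 1`, and the multiplier `m y` puts it back; no
-- division occurs, so `m y = 0` is allowed.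
product-contractSizes : ∀ (m : Fin (suc k) → ℕ) p y →
  m y * product (contractSizes m p y) ≡ (p + m y ∸ 1) * product m
product-contractSizes m p y = begin
  m y * product (contractSizes m p y)
    ≡⟨ cong (m y *_) (product-remove {i = y} (contractSizes m p y)) ⟩
  m y * (contractSizes m p y y * product (removeAt (contractSizes m p y) y))
    ≡⟨ cong₂ (λ x z → m y * (x * z)) (contractSizes-same m p y) (product-cong (contractSizes-other m p y)) ⟩
  m y * ((p + m y ∸ 1) * product (removeAt m y))
    ≡⟨ *-swap (m y) (p + m y ∸ 1) (product (removeAt m y)) ⟩
  (p + m y ∸ 1) * (m y * product (removeAt m y))
    ≡⟨ cong ((p + m y ∸ 1) *_) (product-remove {i = y} m) ⟨
  (p + m y ∸ 1) * product m             ∎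
  where
  open ≡-Reasoning

sum-const : ∀ k x → sum {k} (const x) ≡ k * x
sum-const zero    x = refl
sum-const (suc k) x = cong (x +_) (sum-const k x)

-- Here `n_a = p + 1` and `m` lists the other blocks. The first term is the deletion of a vertex of
-- block `a`, the sum is over the blocks into which `a` can be merged.
treeCount-recursion : ∀ (m : Fin (suc k) → ℕ) p →
  ((p + sum m ∸ suc (suc k)) P′ k) * (p * product m) + sum (λ y → m y * treeCount (contractSizes m p y))
    ≡ ((p + sum m ∸ suc k) P′ k) * (suc p * product m)
-- A single block is left after the merger, so the only summand is `m zero * 1`.
treeCount-recursion {zero} m p = single p (m zero)
  where
  single : ∀ p x → 1 * (p * (x * 1)) + (x * 1 + 0) ≡ 1 * (suc p * (x * 1))
  single = solve-∀
treeCount-recursion {suc j} m p with product m in Π≡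
-- An empty block among the others makes every summand 0. With this case set aside, all sizes in `m`
-- are positive and the subtractions below are exact.
... | zero = begin
  X * (p * 0) + sum (λ y → m y * treeCount (contractSizes m p y))
    ≡⟨ cong₂ (λ x z → X * x + z) (ℕ.*-zeroʳ p) (trans (sum-cong-≗ vanish) (sum-replicate-zero (suc (suc j)))) ⟩
  X * 0 + 0 ≡⟨ trans (ℕ.+-identityʳ _) (ℕ.*-zeroʳ X) ⟩
  0         ≡⟨ ℕ.*-zeroʳ Y ⟨
  Y * 0     ≡⟨ cong (Y *_) (ℕ.*-zeroʳ p) ⟨
  Y * (suc p * 0) ∎
  where
  open ≡-Reasoning
  X = (p + sum m ∸ suc (suc (suc j))) P′ suc j
  Y = (p + sum m ∸ suc (suc j)) P′ suc j
  vanish : ∀ y → m y * treeCount (contractSizes m p y) ≡ 0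
  vanish y = trans (*-swap (m y) (F y) (product (contractSizes m p y)))
    (trans (cong (F y *_) (trans (product-contractSizes m p y)
      (trans (cong ((p + m y ∸ 1) *_) Π≡) (ℕ.*-zeroʳ (p + m y ∸ 1)))))
      (ℕ.*-zeroʳ (F y)))
    where
    F : Fin (suc (suc j)) → ℕ
    F y = (sum (contractSizes m p y) ∸ suc (suc j)) P′ j
... | Π@(suc _) = begin
  ((p + sum m ∸ suc K) P′ suc j) * (p * Π) + sum (λ y → m y * treeCount (contractSizes m p y))
    ≡⟨ cong₂ (λ x z → (x P′ suc j) * (p * Π) + z)
         (trans (sym (ℕ.pred[m∸n]≡m∸[1+n] (p + sum m) K)) (cong pred excess))
         (trans (sum-cong-≗ term) (sym (*-distribʳ-sum (F * Π) (λ y → p + q y)))) ⟩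
  (pred (p + Q) P′ suc j) * (p * Π) + sum (λ y → p + q y) * (F * Π)
    ≡⟨ cong (λ z → (pred (p + Q) P′ suc j) * (p * Π) + z * (F * Π))
         (trans (∑-distrib-+ (const p) q) (cong (_+ Q) (sum-const K p))) ⟩
  (pred (p + Q) P′ suc j) * (p * Π) + (K * p + Q) * (F * Π)
    ≡⟨ factor (pred (p + Q) P′ suc j) p Π (K * p + Q) F ⟩
  ((pred (p + Q) P′ suc j) * p + F * (K * p + Q)) * Π
    ≡⟨ cong (_* Π) (P′-recursion j p Q) ⟩
  ((p + Q) P′ suc j) * suc p * Π
    ≡⟨ ℕ.*-assoc ((p + Q) P′ suc j) (suc p) Π ⟩
  ((p + Q) P′ suc j) * (suc p * Π)
    ≡⟨ cong (λ x → (x P′ suc j) * (suc p * Π)) excess ⟨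
  ((p + sum m ∸ K) P′ suc j) * (suc p * Π) ∎
  where
  open ≡-Reasoning
  K = suc (suc j)
  q : Fin K → ℕ
  q y = pred (m y)
  Q = sum q
  F = pred (p + Q) P′ j
  m≡ : ∀ y → m y ≡ suc (q y)
  m≡ y with m y in my
  ... | suc _ = refl
  ... | zero with () ← trans (sym Π≡)
    (trans (product-remove {i = y} m) (cong (_* product (removeAt m y)) my))
  excess : p + sum m ∸ K ≡ p + Q
  excess = begin
    p + sum m ∸ K        ≡⟨ cong (λ z → p + z ∸ K) (trans (sum-cong-≗ m≡)
           (trans (∑-distrib-+ (const 1) q) (cong (_+ Q) (trans (sum-const K 1) (ℕ.*-identityʳ K))))) ⟩
    p + (K + Q) ∸ K      ≡⟨ cong (_∸ K) (shift p K Q) ⟩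
    K + (p + Q) ∸ K      ≡⟨ ℕ.m+n∸m≡n K (p + Q) ⟩
    p + Q                ∎
    where
    shift : ∀ x y z → x + (y + z) ≡ y + (x + z)
    shift = solve-∀
  term : ∀ y → m y * treeCount (contractSizes m p y) ≡ (p + q y) * (F * Π)
  term y = begin
    m y * (G * product (contractSizes m p y))
      ≡⟨ *-swap (m y) G (product (contractSizes m p y)) ⟩
    G * (m y * product (contractSizes m p y))   ≡⟨ cong (G *_) (product-contractSizes m p y) ⟩
    G * ((p + m y ∸ 1) * product m)
      ≡⟨ cong₂ (λ g x → g * (x * product m)) G≡F
           (trans (cong (λ z → p + z ∸ 1) (m≡ y)) (cong (_∸ 1) (ℕ.+-suc p (q y)))) ⟩
    F * ((p + q y) * product m)                 ≡⟨ cong (λ z → F * ((p + q y) * z)) Π≡ ⟩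
    F * ((p + q y) * Π)                         ≡⟨ *-swap F (p + q y) Π ⟩
    (p + q y) * (F * Π)                         ∎
    where
    G = (sum (contractSizes m p y) ∸ K) P′ j
    G≡F : G ≡ F
    G≡F = cong (_P′ j) (begin
      sum (contractSizes m p y) ∸ K  ≡⟨ cong (_∸ K) (sum-contractSizes m p y (m≡ y)) ⟩
      (p + sum m ∸ 1) ∸ K            ≡⟨ ℕ.∸-+-assoc (p + sum m) 1 K ⟩
      p + sum m ∸ suc K              ≡⟨ ℕ.pred[m∸n]≡m∸[1+n] (p + sum m) K ⟨
      pred (p + sum m ∸ K)           ≡⟨ cong pred excess ⟩
      pred (p + Q)                   ∎)
  factor : ∀ X p Π S F → X * (p * Π) + S * (F * Π) ≡ (X * p + F * S) * Π
  factor = solve-∀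

-- Summation over the fibres and the induction

fibreCount-sum : ∀ (A : Fin (suc n) → Bool) (ℓ : Fin (suc n) → Fin (suc (suc k))) →
                 sum (fibreCount A ℓ) ≡ treeCount (blockSize A ℓ)
fibreCount-sum {n} {k} A ℓ with A zero
... | false = trans (cong (treeCount (blockSize A′ ℓ′) +_) (sum-replicate-zero n)) (ℕ.+-identityʳ _)
  where
  A′ = A ∘ suc
  ℓ′ = ℓ ∘ suc
... | true = begin
  treeCount b + sum (joinedCount A ℓ)
    ≡⟨ cong₂ _+_ (cong₂ (λ s Π → ((s ∸ suc (suc k)) P′ k) * Π)
         (sum-remove {i = a} b) (product-remove {i = a} b)) joined ⟩
  ((p + sum m ∸ suc (suc k)) P′ k) * (p * product m) + sum (λ y → m y * treeCount (contractSizes m p y))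
    ≡⟨ treeCount-recursion m p ⟩
  ((suc p + sum m ∸ suc (suc k)) P′ k) * (suc p * product m)
    ≡⟨ cong₂ (λ s Π → ((s ∸ suc (suc k)) P′ k) * Π)
         (trans (sum-remove {i = a} b⁺) (cong₂ _+_ at-a (sum-cong-≗ off-a)))
         (trans (product-remove {i = a} b⁺) (cong₂ _*_ at-a (product-cong off-a))) ⟨
  treeCount b⁺ ∎
  where
  open ≡-Reasoning
  A′ = A ∘ suc
  ℓ′ = ℓ ∘ suc
  a = ℓ zero
  b b⁺ : Fin (suc (suc k)) → ℕ
  b = blockSize A′ ℓ′
  b⁺ i = 1 * δ a i + b i
  p = b a
  m = removeAt b a
  at-a : b⁺ a ≡ suc p
  at-a = cong (λ x → 1 * x + p) (δ-refl a)
  off-a : ∀ x → b⁺ (punchIn a x) ≡ m x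
  off-a x = cong (λ z → 1 * z + m x) (δ-≢ (punchInᵢ≢i a x ∘ sym))

  -- The count for a partner uses a proof that its block differs from `a`; `H` makes it a function
  -- of the block alone, so that `sum-blocks` applies. The value 0 at `a` records that block `a`
  -- contains no partner.
  H : Fin (suc (suc k)) → ℕ
  H i with a ≟ i
  ... | yes _   = 0
  ... | no  a≢i = treeCount (contractSizes m p (punchOut a≢i))
  H-a : H a ≡ 0
  H-a with a ≟ a
  ... | yes _   = refl
  ... | no  a≢a = contradiction refl a≢a
  H-punchIn : ∀ y → H (punchIn a y) ≡ treeCount (contractSizes m p y)
  H-punchIn y with a ≟ punchIn a y
  ... | yes a≡  = contradiction (sym a≡) (punchInᵢ≢i a y)
  ... | no  a≢i = cong (treeCount ∘ contractSizes m p)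
    (trans (punchOut-cong a refl) (punchOut-punchIn a))

  joinedCount≡ : ∀ w → joinedCount A ℓ w ≡ ⟦ A′ w ⟧ * H (ℓ′ w)
  joinedCount≡ w with A (suc w) in Aw | a ≟ ℓ (suc w)
  ... | false | _       = refl
  ... | true  | yes _   = refl
  ... | true  | no  a≢b = trans (treeCount-cong sizes) (sym (ℕ.*-identityˡ _))
    where
    y = punchOut a≢b
    sizes : ∀ x → blockSize (kill w A′) (merge a≢b ∘ ℓ′) x ≡ contractSizes m p y x
    sizes x = begin
      -- `contractSizes` subtracts what `blockSize-kill` adds, so `δ y x` is first added and
      -- subtracted; nothing is truncated.
      killed x                                 ≡⟨ ℕ.m+n∸m≡n (δ y x) (killed x) ⟨
      δ y x + killed x ∸ δ y x
        ≡⟨ cong (λ z → δ z x + killed x ∸ δ y x) (merge-≢ a≢b a≢b) ⟨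
      δ (merge a≢b (ℓ′ w)) x + killed x ∸ δ y x
        ≡⟨ cong (_∸ δ y x) (blockSize-kill Aw (merge a≢b ∘ ℓ′) x) ⟨
      blockSize A′ (merge a≢b ∘ ℓ′) x ∸ δ y x  ≡⟨ cong (_∸ δ y x) (blockSize-merge a≢b A′ ℓ′ x) ⟩
      contractSizes m p y x                    ∎
      where
      killed = blockSize (kill w A′) (merge a≢b ∘ ℓ′)

  joined : sum (joinedCount A ℓ) ≡ sum (λ y → m y * treeCount (contractSizes m p y))
  joined = begin
    sum (joinedCount A ℓ)                        ≡⟨ sum-cong-≗ joinedCount≡ ⟩
    sum (λ w → ⟦ A′ w ⟧ * H (ℓ′ w))              ≡⟨ sum-blocks A′ ℓ′ H ⟩
    sum (λ i → b i * H i)                        ≡⟨ sum-remove {i = a} (λ i → b i * H i) ⟩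
    p * H a + sum (λ y → m y * H (punchIn a y))
      ≡⟨ cong₂ _+_ (trans (cong (p *_) H-a) (ℕ.*-zeroʳ p))
           (sum-cong-≗ (λ y → cong (m y *_) (H-punchIn y))) ⟩
    sum (λ y → m y * treeCount (contractSizes m p y)) ∎

-- The labelling, the number of blocks and the live set all vary in the induction, because a
-- contraction changes each of them.
trees : ∀ {n k} (A : Fin n → Bool) (ℓ : Fin n → Fin (suc k)) →
        HasCardinality (Trees A ℓ) (treeCount (blockSize A ℓ))
trees {k = zero} A ℓ = trees₁
-- Without vertices two blocks cannot be connected, and the product of the block sizes is 0.
trees {zero} {suc k} A ℓ = subst (HasCardinality (Trees A ℓ))
  (sym (ℕ.*-zeroʳ ((sum (blockSize A ℓ) ∸ suc (suc k)) P′ k))) (cardinality-empty (Trees A ℓ) none)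
  where
  none : ¬ Setoid.Carrier (Trees A ℓ)
  none (T , t) with IsTree.connected t zero (suc zero)
  ... | (() , _) ◅ _
trees {suc n} {suc k} A ℓ = subst (HasCardinality (Trees A ℓ)) (fibreCount-sum A ℓ)
  (cardinality-fibres (Trees A ℓ) treeNeighbour
    (λ {T} {T′} → treeNeighbour-cong {T = T} {T′}) (fibreCount A ℓ) fibres)
  where
  attached-edge : ∀ {w} →
    (((T , _) , _) : Setoid.Carrier (Fibre (Trees A ℓ) treeNeighbour (suc w))) → E T zero (suc w)
  attached-edge (T , p) = ZeroAttachedTo.edge (treeNeighbour-attached T) (sym p)

  fibres : ∀ i → HasCardinality (Fibre (Trees A ℓ) treeNeighbour i) (fibreCount A ℓ i)
  fibres zero = inverse isolatedTree (trees (A ∘ suc) (ℓ ∘ suc))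
  fibres (suc w) with A zero in Azero
  ... | false = cardinality-empty _ λ { x@((T , t) , _) →
    contradiction (trans (sym Azero) (IsTree.alive t (attached-edge x))) λ () }
  ... | true with A (suc w) in Aw | ℓ zero ≟ ℓ (suc w)
  ...   | true  | no a≢b = inverse (joinedTree a≢b Azero Aw) (trees _ _)
  ...   | true  | yes p  = cardinality-empty _ λ { x@((T , t) , _) →
    IsTree.crossing t (attached-edge x) p }
  ...   | false | _      = cardinality-empty _ λ { x@((T , t) , _) →
    contradiction (trans (sym Aw) (IsTree.alive t (E-sym T (attached-edge x)))) λ () }

-- Translation to the quantities of the statement

product-tabulate : ∀ {k} {A : Set} (f : A → ℕ) (g : Fin k → A) →
  ListAction.product (List.map f (List.tabulate g)) ≡ product (f ∘ g)
product-tabulate {zero}  f g = refl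
product-tabulate {suc k} f g = cong (f (g zero) *_) (product-tabulate f (g ∘ suc))

-- The factor `1` is the value of `⟦ true ⟧`, so the right side agrees by computation with
-- `blockSize (const true)`.
∣tabulate∣ : (f : Fin n → Bool) → ∣ Vec.tabulate f ∣ ≡ sum (λ v → 1 * ⟦ f v ⟧)
∣tabulate∣ {zero}  f = refl
∣tabulate∣ {suc n} f with f zero
... | true  = cong suc (∣tabulate∣ (f ∘ suc))
... | false = ∣tabulate∣ (f ∘ suc)

sum-blockSize : (ℓ : Fin n → Fin k) → sum (blockSize (const true) ℓ) ≡ n
sum-blockSize {n} ℓ = begin
  sum (blockSize (const true) ℓ)
    ≡⟨ sum-cong-≗ (λ i → ℕ.*-identityʳ (blockSize (const true) ℓ i)) ⟨
  sum (λ i → blockSize (const true) ℓ i * 1)   ≡⟨ sum-blocks (const true) ℓ (const 1) ⟨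
  sum {n} (const 1)                            ≡⟨ sum-const n 1 ⟩
  n * 1                                        ≡⟨ ℕ.*-identityʳ n ⟩
  n ∎
  where open ≡-Reasoning

module _ (G : MultipartiteGraph n k) where
  open MultipartiteGraph G using (part; block; IsComplete)

  interconnectionTrees↔trees : IsComplete → Inverse (IT G) (Trees (const true) part)
  interconnectionTrees↔trees complete = record
    { to        = λ (T , t) → T , interconnectionTree⇒tree G complete T t
    ; from      = λ (T , t) → T , tree⇒interconnectionTree G complete T t
    ; to-cong   = id
    ; from-cong = id
    ; inverse   = id , id
    }

  ∏∣blocks∣≡ : ∏∣blocks∣ G ≡ product (blockSize (const true) part)
  ∏∣blocks∣≡ = trans (product-tabulate (λ i → ∣ block i ∣) id)
    (product-cong λ i → ∣tabulate∣ (λ v → does (part v ≟ i)))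

theorem11 : ∀ (n k : ℕ) → 2 ≤ k →
    (G : MultipartiteGraph n k) → MultipartiteGraph.IsComplete G →
    HasCardinality (IT G)
    ((k ∸ 2) ! * ((n ∸ k) C (k ∸ 2)) * ∏∣blocks∣ G)
theorem11 n k@(suc (suc j)) (s≤s (s≤s z≤n)) G complete =
  subst (HasCardinality (IT G)) count
    (inverse (interconnectionTrees↔trees G complete) (trees (const true) part))
  where
  open MultipartiteGraph G using (part)
  open ≡-Reasoning
  b = blockSize (const true) part
  count : treeCount b ≡ j ! * ((n ∸ k) C j) * ∏∣blocks∣ G
  count = begin
    ((sum b ∸ k) P′ j) * product b
      ≡⟨ cong₂ (λ s Π → ((s ∸ k) P′ j) * Π)
           (sum-blockSize part) (sym (∏∣blocks∣≡ G)) ⟩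
    ((n ∸ k) P′ j) * ∏∣blocks∣ G            ≡⟨ cong (_* ∏∣blocks∣ G) (k!*nCk≡nP′k (n ∸ k) j) ⟨
    j ! * ((n ∸ k) C j) * ∏∣blocks∣ G       ∎
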